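{- Let $(\mathcal{X},d)$ be a finite metric space, $P$ a probability distribution on $\mathcal{X}$, and $k\ge1$ an integer; let $O$ be a $k$-multiset minimizing $\mathbb{E}_{X\sim P_k}[d_k(O,X)]$. Let $S$ be a random $k$-multiset drawn from the variance-reduced distribution $\widetilde P_k$, independently of $X$. Then $$\mathbb{E}_{S\sim\widetilde P_k}\mathbb{E}_{X\sim P_k}[d_k(S,X)]\le 4\cdot\mathbb{E}_{X\sim P_k}[d_k(O,X)].$$
   Context: For $k$-multisets $U,V$ of points of $\mathcal{X}$, $d_k(U,V)$ is the minimum total cost $\sum d(u,v)$ of a perfect matching between $U$ and $V$ (repeated points treated as distinct copies); $P_k$ is the distribution of the multiset of $k$ points drawn i.i.d. from $P$. The variance-reduced distribution $\widetilde P_k$ on $k$-multisets is defined as follows: the multiset contains $\lfloor P(x)k\rfloor$ copies of each $x\in\mathcal{X}$, and each of the remaining $k-\sum_{x}\lfloor P(x)k\rfloor$ points (if any) is drawn independently, with point $x$ chosen with probability $\frac{P(x)-\lfloor P(x)k\rfloor/k}{\sum_{y\in\mathcal{X}}(P(y)-\lfloor P(y)k\rfloor/k)}$.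
   Formalization: The distances d(x,y) of the finite metric space and the probabilities P(x) are taken to be rational numbers instead of real numbers. -}

module Defs where

open import Data.Nat as ℕ using (ℕ; zero; suc; _∸_)
open import Data.Integer as ℤ using (ℤ; +_; -[1+_])
open import Data.Rational using (ℚ; mkℚ; 0ℚ; 1ℚ; _+_; _*_; _-_; _≤_; _⊓_; _/_; 1/_; floor)
open import Data.Fin using (Fin)
import Data.Fin as Fin
open import Data.List using (List; []; _∷_; map; foldr; replicate; concatMap; allFin; _++_)
open import Data.Product using (_×_; _,_)
open import Relation.Binary.PropositionalEquality using (_≡_)

sumFin : ∀ {n} → (Fin n → ℚ) → ℚ
sumFin {zero}  f = 0ℚ
sumFin {suc n} f = f Fin.zero + sumFin (λ i → f (Fin.suc i))

sumFinℕ : ∀ {n} → (Fin n → ℕ) → ℕ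
sumFinℕ {zero}  f = 0
sumFinℕ {suc n} f = f Fin.zero ℕ.+ sumFinℕ (λ i → f (Fin.suc i))

record IsMetric {n : ℕ} (d : Fin n → Fin n → ℚ) : Set where
  field
    nonneg   : ∀ x y → 0ℚ ≤ d x y
    zero-eq  : ∀ x y → d x y ≡ 0ℚ → x ≡ y
    eq-zero  : ∀ x → d x x ≡ 0ℚ
    symm     : ∀ x y → d x y ≡ d y x
    triangle : ∀ x y z → d x z ≤ d x y + d y z

record IsProb {n : ℕ} (P : Fin n → ℚ) : Set where
  field
    nonneg : ∀ x → 0ℚ ≤ P x
    total  : sumFin P ≡ 1ℚ

picks : {A : Set} → List A → List (A × List A)
picks []       = []
picks (x ∷ xs) = (x , xs) ∷ map (λ { (y , ys) → (y , x ∷ ys) }) (picks xs)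

-- minimum of a list (junk value 0 on the empty list, never used below)
minList : List ℚ → ℚ
minList []       = 0ℚ
minList (a ∷ as) = foldr _⊓_ a as

-- d_k : minimum cost of a perfect matching between two k-multisets
-- (represented as lists; repeated points are distinct copies).
-- Lists of unequal length get a junk value; only equal lengths occur.
matchCost : ∀ {n} → (Fin n → Fin n → ℚ) → List (Fin n) → List (Fin n) → ℚ
matchCost d []       []      = 0ℚ
matchCost d []       (_ ∷ _) = 0ℚ
matchCost d (u ∷ us) vs      =
  minList (map (λ { (v , rest) → d u v + matchCost d us rest }) (picks vs))

expectIID : ∀ {n} → (Fin n → ℚ) → (k : ℕ) → (List (Fin n) → ℚ) → ℚ
expectIID p zero    f = f []
expectIID p (suc k) f = sumFin (λ x → p x * expectIID p k (λ xs → f (x ∷ xs)))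

-- inverse with junk value 0 at 0
inv : ℚ → ℚ
inv p@(mkℚ (+ zero) _ _)   = 0ℚ
inv p@(mkℚ (+ suc _) _ _)  = 1/ p
inv p@(mkℚ -[1+ _ ] _ _)   = 1/ p

module VarianceReduced {n : ℕ} (P : Fin n → ℚ) (k : ℕ) .{{_ : ℕ.NonZero k}} where
  cnt : Fin n → ℕ
  cnt x = ℤ.∣ floor (P x * (+ k / 1)) ∣

  base : List (Fin n)
  base = concatMap (λ x → replicate (cnt x) x) (allFin n)

  rest : ℕ
  rest = k ∸ sumFinℕ cnt

  w : Fin n → ℚ
  w x = P x - (+ cnt x / k)

  q : Fin n → ℚ
  q x = w x * inv (sumFin w)

  expect : (List (Fin n) → ℚ) → ℚ
  expect f = expectIID q rest (λ extra → f (base ++ extra))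

expectVR : ∀ {n} → (Fin n → ℚ) → (k : ℕ) → .{{_ : ℕ.NonZero k}} → (List (Fin n) → ℚ) → ℚ
expectVR P k f = VarianceReduced.expect P k f

expCost : ∀ {n} → (Fin n → Fin n → ℚ) → (Fin n → ℚ) → (k : ℕ) → List (Fin n) → ℚ
expCost d P k U = expectIID P k (λ X → matchCost d U X)

{-# OPTIONS --safe #-}
-- For a fixed k-multiset X put f(S) = d_k(S, X). The point is that E f(S) for S drawn from the
-- variance-reduced distribution is at most E f(Y) for Y drawn from P_k. Granted this, average
-- over X and use d_k(Y, X) ≤ d_k(Y, O) + d_k(O, X): the left-hand side is at most twice
-- E d_k(O, X), whatever O is.
--
-- The variance-reduced sample consists of k independent points whose distributions have average
-- P. Replacing a pair b + (1+c)E, b − E of these distributions by b + cE, b raises E f by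
-- (1+c) times the quadratic form Σ E(x) E(y) f(x,y,Z), averaged over the remaining points Z.
-- So it suffices that g(x,y) = f(x,y,Z) is positive semidefinite on weights E of total 0. An
-- alternating-path exchange between optimal matchings shows that, of g(x,y) + g(u,v) and its two
-- rearrangements, the first is never strictly the smallest; a Gromov product turns this
-- four-point condition into an ultrametric similarity, which is positive semidefinite.
module Submission where

open import Defs
open import Algebra.Bundles using (CommutativeRing)
open import Data.Empty using (⊥-elim)
open import Data.Fin using (Fin; zero; suc; punchIn)
open import Data.Fin.Properties using (punchInᵢ≢i) renaming (_≟_ to _≟ᶠ_)
open import Data.Integer as ℤ using (+_; -[1+_])
import Data.Integer.Properties as ℤ
open import Data.Nat.DivMod using (m/n*n≤m)
open import Data.Rational.Unnormalised as ℚᵘ using (mkℚᵘ)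
import Data.Rational.Unnormalised.Properties as ℚᵘ
open import Data.List using (List; []; _∷_; map; foldr; replicate; concatMap; _++_; length; tabulate)
open import Data.List.Properties using (length-replicate; length-++; length-map; map-++; map-replicate; ++-identityʳ)
open import Data.List.Membership.Propositional using (_∈_)
open import Data.List.Membership.Propositional.Properties using (∈-∃++; ∈-map⁺; ∈-map⁻)
open import Data.List.Relation.Unary.All as All using (All; []; _∷_)
import Data.List.Relation.Unary.All.Properties as All
open import Data.List.Relation.Unary.Any using (here; there)
open import Data.List.Relation.Binary.Permutation.Propositional
  using (_↭_; prep; ↭-refl; ↭-sym; ↭-trans) renaming (swap to ↭-swap₂)
open import Data.List.Relation.Binary.Permutation.Propositional.Properties
  using (↭-length; ∈-resp-↭; shift; drop-∷; ↭-empty-inv)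
open import Data.Nat as ℕ using (ℕ; zero; suc; NonZero)
import Data.Nat.Properties as ℕ
open import Data.Product using (∃; ∃₂; _×_; _,_; proj₁; proj₂)
open import Data.Rational
  using (ℚ; mkℚ; toℚᵘ; 0ℚ; 1ℚ; _+_; _*_; _-_; -_; _≤_; _<_; _⊓_; _/_; 1/_; floor;
         nonNegative; positive; *≤*)
open import Data.Rational.Properties
open import Data.Rational.Solver using (module +-*-Solver)
open import Data.Sum using (_⊎_; inj₁; inj₂)
open import Data.Vec using (Vec; toList)
open import Data.Vec.Properties using (length-toList)
open import Function using (_∘_; id)
open import Relation.Binary.Definitions using (tri<; tri≈; tri>)
open import Relation.Binary.PropositionalEquality
  using (_≡_; _≢_; refl; sym; trans; cong; cong₂; subst; subst₂; module ≡-Reasoning)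
open import Relation.Nullary using (Dec; yes; no)
open +-*-Solver using (solve; _:=_; _:+_; _:*_; _:-_; :-_; con)

import Algebra.Properties.Semiring.Sum (CommutativeRing.semiring +-*-commutativeRing) as Sum

-- Order in the rationals.

0≤q-p : ∀ {p q} → p ≤ q → 0ℚ ≤ q - p
0≤q-p {p} {q} p≤q = subst (_≤ q - p) (+-inverseʳ p) (+-monoˡ-≤ (- p) p≤q)

0≤q-p⇒p≤q : ∀ {p q} → 0ℚ ≤ q - p → p ≤ q
0≤q-p⇒p≤q {p} {q} h = subst₂ _≤_ (+-identityˡ p)
  (solve 2 (λ p q → q :- p :+ p := q) refl p q) (+-monoˡ-≤ p h)

0≤* : ∀ {p q} → 0ℚ ≤ p → 0ℚ ≤ q → 0ℚ ≤ p * q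
0≤* {p} {q} 0≤p 0≤q = nonNegative⁻¹ _
  {{nonNeg*nonNeg⇒nonNeg p {{nonNegative 0≤p}} q {{nonNegative 0≤q}}}}

*-mono-nonneg : ∀ {c p q} → 0ℚ ≤ c → p ≤ q → c * p ≤ c * q
*-mono-nonneg {c} 0≤c = *-monoˡ-≤-nonNeg c {{nonNegative 0≤c}}

0≤+ : ∀ {p q} → 0ℚ ≤ p → 0ℚ ≤ q → 0ℚ ≤ p + q
0≤+ = +-mono-≤

0≤p*p : ∀ p → 0ℚ ≤ p * p
0≤p*p p with ≤-total 0ℚ p
... | inj₁ 0≤p = 0≤* 0≤p 0≤p
... | inj₂ p≤0 = subst (0ℚ ≤_) (solve 1 (λ p → (:- p) :* (:- p) := p :* p) refl p)
  (0≤* (neg-antimono-≤ p≤0) (neg-antimono-≤ p≤0))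

-- Finite sums.

opaque
  -- Opaque, so that unification can recover the summand from a sum of unknown length.
  ∑ : ∀ {n} → (Fin n → ℚ) → ℚ
  ∑ = sumFin

  ∑≡sumFin : ∀ {n} (f : Fin n → ℚ) → ∑ f ≡ sumFin f
  ∑≡sumFin f = refl

  ∑≡sum : ∀ {n} (f : Fin n → ℚ) → ∑ f ≡ Sum.sum f
  ∑≡sum {zero}  f = refl
  ∑≡sum {suc n} f = cong (_+_ (f zero)) (∑≡sum (f ∘ suc))

  ∑-empty : (f : Fin 0 → ℚ) → ∑ f ≡ 0ℚ
  ∑-empty f = refl

  ∑-cong : ∀ {n} {f g : Fin n → ℚ} → (∀ i → f i ≡ g i) → ∑ f ≡ ∑ g
  ∑-cong {zero}  f≗g = refl
  ∑-cong {suc n} f≗g = cong₂ _+_ (f≗g zero) (∑-cong (f≗g ∘ suc))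

  ∑-mono : ∀ {n} {f g : Fin n → ℚ} → (∀ i → f i ≤ g i) → ∑ f ≤ ∑ g
  ∑-mono {zero}  f≤g = ≤-refl
  ∑-mono {suc n} f≤g = +-mono-≤ (f≤g zero) (∑-mono (f≤g ∘ suc))

∑-+ : ∀ {n} (f g : Fin n → ℚ) → ∑ (λ i → f i + g i) ≡ ∑ f + ∑ g
∑-+ f g = trans (∑≡sum _)
  (trans (Sum.∑-distrib-+ f g) (sym (cong₂ _+_ (∑≡sum f) (∑≡sum g))))

∑-*ˡ : ∀ {n} c (f : Fin n → ℚ) → ∑ (λ i → c * f i) ≡ c * ∑ f
∑-*ˡ c f = trans (∑≡sum _)
  (trans (sym (Sum.*-distribˡ-sum c f)) (cong (c *_) (sym (∑≡sum f))))

∑-*ʳ : ∀ {n} c (f : Fin n → ℚ) → ∑ (λ i → f i * c) ≡ ∑ f * c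
∑-*ʳ c f = trans (∑-cong (λ i → *-comm (f i) c)) (trans (∑-*ˡ c f) (*-comm c _))

∑-0 : ∀ {n} → ∑ {n} (λ _ → 0ℚ) ≡ 0ℚ
∑-0 {n} = trans (∑≡sum {n} (λ _ → 0ℚ)) (Sum.sum-replicate-zero n)

0≤∑ : ∀ {n} {f : Fin n → ℚ} → (∀ i → 0ℚ ≤ f i) → 0ℚ ≤ ∑ f
0≤∑ {n} {f} h = subst (_≤ ∑ f) (∑-0 {n}) (∑-mono h)

∑-swap : ∀ {m n} (f : Fin m → Fin n → ℚ) → ∑ (λ i → ∑ (f i)) ≡ ∑ (λ j → ∑ (λ i → f i j))
∑-swap f = trans (nested f) (trans (Sum.∑-comm f) (sym (nested (λ j i → f i j))))
  where
  nested : ∀ {m n} (f : Fin m → Fin n → ℚ) → ∑ (λ i → ∑ (f i)) ≡ Sum.sum (λ i → Sum.sum (f i))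
  nested f = trans (∑≡sum (λ i → ∑ (f i))) (Sum.sum-cong-≗ (λ i → ∑≡sum (f i)))

∑-remove : ∀ {n} (i : Fin (suc n)) f → ∑ f ≡ f i + ∑ (f ∘ punchIn i)
∑-remove i f = trans (∑≡sum f)
  (trans (Sum.sum-remove {i = i} f) (cong (_+_ (f i)) (sym (∑≡sum (f ∘ punchIn i)))))

-- Bilinear forms of kernels.

form : ∀ {n} → (Fin n → ℚ) → (Fin n → ℚ) → (Fin n → Fin n → ℚ) → ℚ
form E F g = ∑ λ x → E x * ∑ λ y → F y * g x y

form-cong : ∀ {n} (E F : Fin n → ℚ) {g h} → (∀ x y → g x y ≡ h x y) → form E F g ≡ form E F h
form-cong E F g≗h = ∑-cong λ x → cong (E x *_) (∑-cong λ y → cong (F y *_) (g≗h x y))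

form-+ : ∀ {n} (E F : Fin n → ℚ) g h →
  form E F (λ x y → g x y + h x y) ≡ form E F g + form E F h
form-+ E F g h = trans (∑-cong step) (∑-+ _ _)
  where
  step : ∀ x → E x * ∑ (λ y → F y * (g x y + h x y)) ≡
               E x * ∑ (λ y → F y * g x y) + E x * ∑ (λ y → F y * h x y)
  step x = trans
    (cong (E x *_) (trans (∑-cong λ y → *-distribˡ-+ (F y) (g x y) (h x y)) (∑-+ _ _)))
    (*-distribˡ-+ (E x) _ _)

form-left : ∀ {n} (E F h : Fin n → ℚ) →
  form E F (λ x _ → h x) ≡ ∑ (λ x → E x * h x) * ∑ F
form-left E F h = trans
  (∑-cong {f = λ x → E x * ∑ (λ y → F y * h x)} {g = λ x → E x * h x * ∑ F} λ x → trans
                           (cong (E x *_) (trans (∑-*ʳ (h x) F) (*-comm (∑ F) (h x))))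
                           (sym (*-assoc (E x) (h x) (∑ F))))
  (∑-*ʳ (∑ F) (λ x → E x * h x))

form-right : ∀ {n} (E F h : Fin n → ℚ) →
  form E F (λ _ y → h y) ≡ ∑ E * ∑ (λ y → F y * h y)
form-right E F h = ∑-*ʳ (∑ (λ y → F y * h y)) E

-- A point whose row and column vanish contributes nothing and can be deleted; this drives the
-- inductions on the number of points in `min-psd` and `ultra-psd`.
form-remove : ∀ {n} (i : Fin (suc n)) E s → (∀ y → s i y ≡ 0ℚ) → (∀ x → s x i ≡ 0ℚ) →
  form E E s ≡ form (E ∘ punchIn i) (E ∘ punchIn i) (λ x y → s (punchIn i x) (punchIn i y))
form-remove i E s row col = trans (∑-remove i _)
  (trans (cong₂ _+_ rowᵢ (∑-cong λ x → cong (E (punchIn i x) *_) (colᵢ (punchIn i x))))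
         (+-identityˡ (form (E ∘ punchIn i) (E ∘ punchIn i) (λ x y → s (punchIn i x) (punchIn i y)))))
  where
  rowᵢ : E i * ∑ (λ y → E y * s i y) ≡ 0ℚ
  rowᵢ = trans (cong (E i *_) (trans (∑-cong λ y → trans (cong (E y *_) (row y)) (*-zeroʳ (E y))) ∑-0))
               (*-zeroʳ (E i))
  colᵢ : ∀ x → ∑ (λ y → E y * s x y) ≡ ∑ (λ y → E (punchIn i y) * s x (punchIn i y))
  colᵢ x = trans (∑-remove i _)
    (trans (cong (_+ ∑ (λ y → E (punchIn i y) * s x (punchIn i y)))
                 (trans (cong (E i *_) (col x)) (*-zeroʳ (E i)))) (+-identityˡ _))

-- Positive semidefinite kernels.

argmin : ∀ {n} (a : Fin (suc n) → ℚ) → ∃ λ i → ∀ j → a i ≤ a j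
argmin {zero}  a = zero , λ { zero → ≤-refl }
argmin {suc n} a with argmin (a ∘ suc)
... | i , min with ≤-total (a zero) (a (suc i))
...   | inj₁ z≤i = zero , λ { zero → ≤-refl ; (suc j) → ≤-trans z≤i (min j) }
...   | inj₂ i≤z = suc i , λ { zero → i≤z ; (suc j) → min j }

-- Subtracting the least value leaves a kernel of the same kind with a zero row.
min-psd : ∀ {n} (a : Fin n → ℚ) → (∀ x → 0ℚ ≤ a x) → ∀ E → 0ℚ ≤ form E E (λ x y → a x ⊓ a y)
min-psd {zero}  a 0≤a E = ≤-reflexive (sym (∑-empty _))
min-psd {suc n} a 0≤a E = subst (0ℚ ≤_) (sym split)
  (0≤+ (subst (0ℚ ≤_) (sym constant) (0≤* (0≤a i) (0≤p*p (∑ E))))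
       (subst (0ℚ ≤_) (sym (form-remove i E _ row col))
              (min-psd (b ∘ punchIn i) (λ x → 0≤b (punchIn i x)) (E ∘ punchIn i))))
  where
  i = proj₁ (argmin a)
  b : Fin (suc n) → ℚ
  b x = a x - a i
  0≤b : ∀ x → 0ℚ ≤ b x
  0≤b x = 0≤q-p (proj₂ (argmin a) x)
  bᵢ : b i ≡ 0ℚ
  bᵢ = +-inverseʳ (a i)
  row : ∀ y → b i ⊓ b y ≡ 0ℚ
  row y = trans (cong (_⊓ b y) bᵢ) (p≤q⇒p⊓q≡p (0≤b y))
  col : ∀ x → b x ⊓ b i ≡ 0ℚ
  col x = trans (⊓-comm (b x) (b i)) (row x)
  shiftᵢ : ∀ x y → a x ⊓ a y ≡ a i + b x ⊓ b y
  shiftᵢ x y = trans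
    (cong₂ _⊓_ (solve 2 (λ p q → p := q :+ (p :- q)) refl (a x) (a i))
               (solve 2 (λ p q → p := q :+ (p :- q)) refl (a y) (a i)))
    (sym (mono-≤-distrib-⊓ (+-monoʳ-≤ (a i)) (b x) (b y)))
  split : form E E (λ x y → a x ⊓ a y) ≡ form E E (λ _ _ → a i) + form E E (λ x y → b x ⊓ b y)
  split = trans (form-cong E E shiftᵢ) (form-+ E E _ _)
  constant : form E E (λ _ _ → a i) ≡ a i * (∑ E * ∑ E)
  constant = trans (form-left E E (λ _ → a i))
    (trans (cong (_* ∑ E) (∑-*ʳ (a i) E))
           (solve 2 (λ s c → s :* c :* s := c :* (s :* s)) refl (∑ E) (a i)))

-- The strong triangle inequality for similarities, `s x y` at least the minimum of `s x u` and
-- `s u y`, written as a disjunction so that proofs can split on it.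
Ultra : ∀ {n} → (Fin n → Fin n → ℚ) → Set
Ultra s = ∀ x y u → s x u ≤ s x y ⊎ s u y ≤ s x y

-- With a = s 0 the kernel s − min(a x, a y) is again of this kind, and its row 0 vanishes:
-- it is zero at (x, y) unless a x = a y.
ultra-psd : ∀ {n} (s : Fin n → Fin n → ℚ) → (∀ x y → 0ℚ ≤ s x y) → (∀ x y → s x y ≡ s y x) →
  Ultra s → ∀ E → 0ℚ ≤ form E E s
ultra-psd {zero}  s 0≤s s-sym ultra E = ≤-reflexive (sym (∑-empty _))
ultra-psd {suc n} s 0≤s s-sym ultra E = subst (0ℚ ≤_) (sym split)
  (0≤+ (min-psd a (0≤s zero) E)
       (subst (0ℚ ≤_) (sym (form-remove zero E t t-row t-col))
              (ultra-psd (λ x y → t (suc x) (suc y)) (λ x y → 0≤t (suc x) (suc y))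
                         (λ x y → t-sym (suc x) (suc y)) (λ x y u → t-ultra (suc x) (suc y) (suc u))
                         (E ∘ suc))))
  where
  a : Fin (suc n) → ℚ
  a = s zero
  t : Fin (suc n) → Fin (suc n) → ℚ
  t x y = s x y - a x ⊓ a y
  min≤s : ∀ x y → a x ⊓ a y ≤ s x y
  min≤s x y with ultra x y zero
  ... | inj₁ h = ≤-trans (p⊓q≤p (a x) (a y)) (subst (_≤ s x y) (s-sym x zero) h)
  ... | inj₂ h = ≤-trans (p⊓q≤q (a x) (a y)) h
  0≤t : ∀ x y → 0ℚ ≤ t x y
  0≤t x y = 0≤q-p (min≤s x y)
  t-sym : ∀ x y → t x y ≡ t y x
  t-sym x y = cong₂ _-_ (s-sym x y) (⊓-comm (a x) (a y))
  t<0 : ∀ x y → a x < a y → t x y ≡ 0ℚ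
  -- Among the three similarities between `zero`, `x` and `y` the two smallest agree, so `a x < a y`
  -- forces `s x y` to be `a x`.
  t<0 x y ax<ay with ultra zero x y
  ... | inj₁ ay≤ax = ⊥-elim (<-irrefl refl (<-≤-trans ax<ay ay≤ax))
  ... | inj₂ syx≤ax = trans
    (cong₂ _-_ (≤-antisym (subst (_≤ a x) (s-sym y x) syx≤ax)
                          (subst (_≤ s x y) (p≤q⇒p⊓q≡p (<⇒≤ ax<ay)) (min≤s x y)))
               (p≤q⇒p⊓q≡p (<⇒≤ ax<ay)))
    (+-inverseʳ (a x))
  level : ∀ x y → a x ≡ a y ⊎ t x y ≡ 0ℚ
  level x y with <-cmp (a x) (a y)
  ... | tri< lt _ _ = inj₂ (t<0 x y lt)
  ... | tri≈ _ eq _ = inj₁ eq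
  ... | tri> _ _ gt = inj₂ (trans (t-sym x y) (t<0 y x gt))
  t-ultra : Ultra t
  t-ultra x y u with level x u | level u y
  ... | inj₂ z | _ = inj₁ (subst (_≤ t x y) (sym z) (0≤t x y))
  ... | _ | inj₂ z = inj₂ (subst (_≤ t x y) (sym z) (0≤t x y))
  -- Here `a` takes the same value at all three points, so the same minimum is subtracted from all
  -- three similarities.
  ... | inj₁ xu | inj₁ uy with ultra x y u
  ...   | inj₁ h = inj₁ (+-mono-≤ h (≤-reflexive (cong (λ z → - (a x ⊓ z)) uy)))
  ...   | inj₂ h = inj₂ (+-mono-≤ h (≤-reflexive (cong (λ z → - (z ⊓ a y)) (sym xu))))
  t-row : ∀ y → t zero y ≡ 0ℚ
  t-row y = trans (cong (λ z → s zero y - z) (p≥q⇒p⊓q≡q a≤)) (+-inverseʳ (a y))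
    where
    a≤ : a y ≤ a zero
    a≤ with ultra zero zero y
    ... | inj₁ h = h
    ... | inj₂ h = subst (_≤ a zero) (s-sym y zero) h
  t-col : ∀ x → t x zero ≡ 0ℚ
  t-col x = trans (t-sym x zero) (t-row x)
  split : form E E s ≡ form E E (λ x y → a x ⊓ a y) + form E E t
  split = trans
    (form-cong E E λ x y → solve 2 (λ p q → p := q :+ (p :- q)) refl (s x y) (a x ⊓ a y))
    (form-+ E E _ _)

-- For symmetric `g` this is the four-point inequality of tree metrics, imposed on the negative of
-- `g`.
FourPoint : ∀ {n} → (Fin n → Fin n → ℚ) → Set
FourPoint g = ∀ x y u v → (g u y + g x v ≤ g x y + g u v) ⊎ (g v y + g x u ≤ g x y + g u v)

-- The Gromov product of g at a base point w is an ultrametric similarity, and on weights of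
-- total 0 it has the same quadratic form as g.
fourPoint-psd : ∀ {n} (g : Fin n → Fin n → ℚ) → (∀ x y → g x y ≡ g y x) → FourPoint g →
  ∀ E → ∑ E ≡ 0ℚ → 0ℚ ≤ form E E g
fourPoint-psd {zero}  g g-sym four E ∑E≡0 = ≤-reflexive (sym (∑-empty _))
fourPoint-psd {suc n} g g-sym four E ∑E≡0 = subst (0ℚ ≤_) same (ultra-psd s 0≤s s-sym ultra E)
  where
  w : Fin (suc n)
  w = zero
  s : Fin (suc n) → Fin (suc n) → ℚ
  s x y = g x y + ((g w w - g x w) - g w y)
  s-sym : ∀ x y → s x y ≡ s y x
  s-sym x y = trans
    (cong₂ _+_ (g-sym x y) (cong₂ (λ p q → (g w w - p) - q) (g-sym x w) (g-sym w y)))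
    (cong (_+_ (g y x)) (solve 3 (λ c p q → (c :- p) :- q := (c :- q) :- p) refl (g w w) (g w x) (g y w)))
  ultra : Ultra s
  ultra x y u with four x y u w
  ... | inj₁ h = inj₂ (0≤q-p⇒p≤q (subst (0ℚ ≤_)
    (solve 6 (λ xy uw uy xw ww wy → (xy :+ uw) :- (uy :+ xw) :=
       (xy :+ ((ww :- xw) :- wy)) :- (uy :+ ((ww :- uw) :- wy)))
      refl (g x y) (g u w) (g u y) (g x w) (g w w) (g w y)) (0≤q-p h)))
  ... | inj₂ h = inj₁ (0≤q-p⇒p≤q (subst (0ℚ ≤_)
    (trans (cong (λ z → (g x y + z) - (g w y + g x u)) (g-sym u w))
      (solve 6 (λ xy wu wy xu ww xw → (xy :+ wu) :- (wy :+ xu) :=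
         (xy :+ ((ww :- xw) :- wy)) :- (xu :+ ((ww :- xw) :- wu)))
        refl (g x y) (g w u) (g w y) (g x u) (g w w) (g x w))) (0≤q-p h)))
  s-w : ∀ x → s x w ≡ 0ℚ
  s-w x = trans (solve 2 (λ p q → p :+ ((q :- p) :- q) := q :- q) refl (g x w) (g w w)) (+-inverseʳ (g w w))
  0≤s : ∀ x y → 0ℚ ≤ s x y
  -- With the base point as third point, both similarities on the smaller side are 0.
  0≤s x y with ultra x y w
  ... | inj₁ h = subst (_≤ s x y) (s-w x) h
  ... | inj₂ h = subst (_≤ s x y) (trans (s-sym w y) (s-w y)) h
  p q : Fin (suc n) → ℚ
  p x = g w w - g x w
  q y = - g w y
  same : form E E s ≡ form E E g
  same = begin
    form E E s
      ≡⟨ form-+ E E _ _ ⟩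
    form E E g + form E E (λ x y → (g w w - g x w) - g w y)
      ≡⟨ cong (_+_ (form E E g)) (form-+ E E _ _) ⟩
    form E E g + (form E E (λ x _ → g w w - g x w) + form E E (λ _ y → - g w y))
      -- Each correction depends on one variable only, so its form carries the factor `∑ E`.
      ≡⟨ cong (_+_ (form E E g)) (cong₂ _+_
           (trans (form-left E E p) (trans (cong (∑ (λ x → E x * p x) *_) ∑E≡0) (*-zeroʳ (∑ (λ x → E x * p x)))))
           (trans (form-right E E q) (trans (cong (_* ∑ (λ y → E y * q y)) ∑E≡0) (*-zeroˡ (∑ (λ y → E y * q y)))))) ⟩
    form E E g + (0ℚ + 0ℚ)
      ≡⟨ +-identityʳ _ ⟩
    form E E g ∎
    where open ≡-Reasoning

-- Perfect matchings and their costs.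

-- A matching of any cost, not only an optimal one. Both lists are taken up to permutation, so no
-- order of the pairs is preferred, whereas `matchCost` always expands along the head of its first
-- list.
data Match {A : Set} (d : A → A → ℚ) : List A → List A → ℚ → Set where
  nil : Match d [] [] 0ℚ
  add : ∀ {U T U′ T′ c} u t → U′ ↭ u ∷ U → T′ ↭ t ∷ T → Match d U T c → Match d U′ T′ (d u t + c)

swap-prep : ∀ {A : Set} {x y : A} {xs ys} → xs ↭ y ∷ ys → x ∷ xs ↭ y ∷ x ∷ ys
swap-prep {x = x} {y} p = ↭-trans (prep x p) (↭-swap₂ x y ↭-refl)

∈⇒↭∷ : ∀ {A : Set} {x : A} {xs} → x ∈ xs → ∃ λ ys → xs ↭ x ∷ ys
∈⇒↭∷ x∈xs with ∈-∃++ x∈xs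
... | ys , zs , refl = ys ++ zs , shift _ ys zs

∷↭∷⁻ : ∀ {A : Set} {x y : A} {xs ys} → x ∷ xs ↭ y ∷ ys →
  (x ≡ y × xs ↭ ys) ⊎ ∃ λ zs → ys ↭ x ∷ zs × xs ↭ y ∷ zs
∷↭∷⁻ p with ∈-resp-↭ p (here refl)
... | here refl  = inj₁ (refl , drop-∷ p)
... | there x∈ys with ∈⇒↭∷ x∈ys
...   | zs , q = inj₂ (zs , q , drop-∷ (↭-trans p (swap-prep q)))

[]↭̸∷ : ∀ {A : Set} {B : Set} {x : A} {xs} → [] ↭ x ∷ xs → B
[]↭̸∷ p with ↭-empty-inv (↭-sym p)
... | ()

module _ {A : Set} {d : A → A → ℚ} where

  match-resp : ∀ {U T U′ T′ c} → U ↭ U′ → T ↭ T′ → Match d U T c → Match d U′ T′ c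
  match-resp p q nil
    with refl ← ↭-empty-inv (↭-sym p) | refl ← ↭-empty-inv (↭-sym q) = nil
  match-resp p q (add u t pU pT m) = add u t (↭-trans (↭-sym p) pU) (↭-trans (↭-sym q) pT) m

  match-flip : ∀ {U T c} → Match d U T c → Match (λ x y → d y x) T U c
  match-flip nil               = nil
  match-flip (add u t pU pT m) = add t u pT pU (match-flip m)

  -- If the outermost pair is not that of `x`, then `x` lies in the remaining matching; the
  -- recursion finds its partner there and the outer pair is put back.
  match-left : ∀ {U T c x V} → Match d U T c → U ↭ x ∷ V →
    ∃ λ t → ∃₂ λ S b → T ↭ t ∷ S × Match d V S b × c ≡ d x t + b
  match-left nil p = []↭̸∷ p
  match-left {x = x} (add u t pU pT m) p with ∷↭∷⁻ (↭-trans (↭-sym p) pU)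
  ... | inj₁ (refl , q) = t , _ , _ , pT , match-resp (↭-sym q) ↭-refl m , refl
  ... | inj₂ (zs , q , r) with match-left m q
  ...   | s , S , b , pS , m′ , refl =
    s , t ∷ S , d u t + b , ↭-trans pT (swap-prep pS) , add u t r ↭-refl m′ ,
    solve 3 (λ p q b → p :+ (q :+ b) := q :+ (p :+ b)) refl (d u t) (d x s) b

  match-[] : ∀ {T c} → Match d [] T c → T ≡ [] × c ≡ 0ℚ
  match-[] nil              = refl , refl
  match-[] (add _ _ pU _ _) = []↭̸∷ pU

  match-nonneg : (∀ x y → 0ℚ ≤ d x y) → ∀ {U T c} → Match d U T c → 0ℚ ≤ c
  match-nonneg 0≤d nil             = ≤-refl
  match-nonneg 0≤d (add u t _ _ m) = 0≤+ (0≤d u t) (match-nonneg 0≤d m)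

  -- Compose the matchings: `u` is joined to the partner in `W` of its partner in `V`.
  match-triangle : (∀ x y z → d x z ≤ d x y + d y z) → ∀ {U V W b c} →
    Match d U V b → Match d V W c → ∃ λ a → Match d U W a × a ≤ b + c
  match-triangle tri nil m₂ with match-[] m₂
  ... | refl , refl = 0ℚ , nil , ≤-refl
  match-triangle tri (add {c = b} u v pU pV m₁) m₂ with match-left m₂ pV
  ... | w , W , c , pW , m₂′ , refl with match-triangle tri m₁ m₂′
  ...   | a , m , a≤b+c = d u w + a , add u w pU pW m ,
    ≤-trans (+-mono-≤ (tri u v w) a≤b+c)
            (≤-reflexive (solve 4 (λ p q b c → (p :+ q) :+ (b :+ c) := (p :+ b) :+ (q :+ c))
                                refl (d u v) (d v w) b c))

match-right : ∀ {A : Set} {d : A → A → ℚ} {U T c t S} → Match d U T c → T ↭ t ∷ S →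
  ∃ λ u → ∃₂ λ V b → U ↭ u ∷ V × Match d V S b × c ≡ d u t + b
match-right m p with match-left (match-flip m) p
... | u , V , b , pV , m′ , eq = u , V , b , pV , match-flip m′ , eq

-- Exchange along alternating paths.

module _ {A : Set} {d : A → A → ℚ} where

  -- In the two left lists `x` has changed places with `u` or with `v`, as in the two alternatives
  -- of `FourPoint`. Only the sum of the costs is prescribed.
  Exchanged : A → A → A → A → List A → List A → ℚ → Set
  Exchanged x y u v Z T c = ∃₂ λ a b → a + b ≡ c ×
    ((Match d (u ∷ y ∷ Z) T a × Match d (x ∷ v ∷ Z) T b) ⊎
     (Match d (v ∷ y ∷ Z) T a × Match d (x ∷ u ∷ Z) T b))

  -- Follow the path from x that alternates between the two matchings until it reaches u or v,
  -- and interchange the matchings along it.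
  exchange : ∀ k {x y u v Z T c₁ c₂} → length Z ≡ k →
    Match d (x ∷ y ∷ Z) T c₁ → Match d (u ∷ v ∷ Z) T c₂ → Exchanged x y u v Z T (c₁ + c₂)
  exchange k {x} {y} {u} {v} {Z} |Z| m₁ m₂ with match-left m₁ ↭-refl
  ... | t , S , b₁ , pT , n₁ , refl with match-right m₂ pT
  ... | z , V , b₂ , pV , n₂ , refl with ∷↭∷⁻ (↭-sym pV)
  -- The first matching joins `x` to `t` and the second joins `t` to `z`. If `z` is `u`, or `v` as
  -- below, the path ends and the two edges at `t` are interchanged.
  ... | inj₁ (refl , q) = d u t + b₁ , d x t + b₂ ,
    solve 4 (λ p q b c → (p :+ b) :+ (q :+ c) := (q :+ b) :+ (p :+ c)) refl (d u t) (d x t) b₁ b₂ ,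
    inj₁ (add u t ↭-refl pT n₁ , add x t ↭-refl pT (match-resp q ↭-refl n₂))
  ... | inj₂ (V′ , q , r) with ∷↭∷⁻ (↭-sym q)
  ... | inj₁ (refl , s) = d v t + b₁ , d x t + b₂ ,
    solve 4 (λ p q b c → (p :+ b) :+ (q :+ c) := (q :+ b) :+ (p :+ c)) refl (d v t) (d x t) b₁ b₂ ,
    inj₂ (add v t ↭-refl pT n₁ , add x t ↭-refl pT (match-resp (↭-trans r (prep u s)) ↭-refl n₂))
  -- The recursion descends on the length `k` of `Z`, as `V″` is not a subterm of `Z`. An empty `Z`
  -- cannot contain `z`.
  exchange zero {Z = []} |Z| m₁ m₂ | t , S , b₁ , pT , n₁ , refl | z , V , b₂ , pV , n₂ , refl
      | inj₂ (V′ , q , r) | inj₂ (V″ , s , s′) = []↭̸∷ s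
  -- Now `z` lies in `Z`, hence in both left lists. The path continues from `z` in the matchings
  -- without `t`; afterwards `t` is joined to `z` in the first and to `x` in the second.
  exchange (suc k) {x} {y} {u} {v} {Z} |Z| m₁ m₂
      | t , S , b₁ , pT , n₁ , refl | z , V , b₂ , pV , n₂ , refl
      | inj₂ (V′ , q , r) | inj₂ (V″ , s , s′)
    with exchange k {z} {y} {u} {v} {V″} (ℕ.suc-injective (trans (sym (↭-length s)) |Z|))
           (match-resp (swap-prep s) ↭-refl n₁) (match-resp (↭-trans r (prep u s′)) ↭-refl n₂)
  ... | a , b , eq , res = d z t + a , d x t + b ,
    trans (solve 4 (λ p q a b → (p :+ a) :+ (q :+ b) := (p :+ q) :+ (a :+ b)) refl (d z t) (d x t) a b)
      (trans (cong (_+_ (d z t + d x t)) eq)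
        (solve 4 (λ p q b c → (p :+ q) :+ (b :+ c) := (q :+ b) :+ (p :+ c)) refl (d z t) (d x t) b₁ b₂)) ,
    reattach res
    where
    reattach : (Match d (u ∷ y ∷ V″) S a × Match d (z ∷ v ∷ V″) S b) ⊎
               (Match d (v ∷ y ∷ V″) S a × Match d (z ∷ u ∷ V″) S b) →
               (Match d (u ∷ y ∷ Z) _ (d z t + a) × Match d (x ∷ v ∷ Z) _ (d x t + b)) ⊎
               (Match d (v ∷ y ∷ Z) _ (d z t + a) × Match d (x ∷ u ∷ Z) _ (d x t + b))
    reattach (inj₁ (l , r)) =
      inj₁ (add z t (swap-prep (swap-prep s)) pT l , add x t (prep x (swap-prep s)) pT r)
    reattach (inj₂ (l , r)) =
      inj₂ (add z t (swap-prep (swap-prep s)) pT l , add x t (prep x (swap-prep s)) pT r)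

-- `matchCost` as a minimum over matchings.

minList-∈ : ∀ a as → minList (a ∷ as) ∈ a ∷ as
minList-∈ a []       = here refl
minList-∈ a (b ∷ as) with ⊓-sel b (foldr _⊓_ a as) | minList-∈ a as
... | inj₁ eq | _       = there (here eq)
... | inj₂ eq | here h  = here (trans eq h)
... | inj₂ eq | there h = there (there (subst (_∈ as) (sym eq) h))

minList-≤ : ∀ {x as} → x ∈ as → minList as ≤ x
minList-≤ {as = a ∷ as} (here refl) = ≤-head as
  where
  ≤-head : ∀ as → foldr _⊓_ a as ≤ a
  ≤-head []       = ≤-refl
  ≤-head (b ∷ as) = ≤-trans (p⊓q≤q b _) (≤-head as)
minList-≤ {as = a ∷ as} (there x∈as) = ≤-tail x∈as
  where
  ≤-tail : ∀ {x as} → x ∈ as → foldr _⊓_ a as ≤ x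
  ≤-tail {as = b ∷ as} (here refl)  = p⊓q≤p b _
  ≤-tail {as = b ∷ as} (there x∈as) = ≤-trans (p⊓q≤q b _) (≤-tail x∈as)

-- The minimum is attained, hence inherits `P`. The membership of `x` excludes the empty list and
-- its default value.
minList-map : ∀ {A : Set} {f : A → ℚ} {x} xs → x ∈ xs → (P : ℚ → Set) →
  (∀ y → y ∈ xs → P (f y)) → P (minList (map f xs))
minList-map {f = f} (x ∷ xs) _ P h with ∈-map⁻ f (minList-∈ (f x) (map f xs))
... | y , y∈xs , eq = subst P (sym eq) (h y y∈xs)

picks-sound : ∀ {A : Set} {y : A} {ys} xs → (y , ys) ∈ picks xs → xs ↭ y ∷ ys
picks-sound (x ∷ xs) (here refl) = ↭-refl
picks-sound (x ∷ xs) (there h) with ∈-map⁻ _ h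
... | (y , ys) , h′ , refl = swap-prep (picks-sound xs h′)

picks-complete : ∀ {A : Set} {y : A} {xs} → y ∈ xs → ∃ λ ys → (y , ys) ∈ picks xs
picks-complete {xs = x ∷ xs} (here refl) = xs , here refl
picks-complete {xs = x ∷ xs} (there h) with picks-complete h
... | ys , h′ = x ∷ ys , there (∈-map⁺ _ h′)

module _ {n} (d : Fin n → Fin n → ℚ) where

  -- With `matchCost-≤` this identifies `matchCost` as the least cost of a `Match`, and the
  -- properties below are read off from matchings. Equal lengths keep the default values away.
  matchCost-match : ∀ U T → length U ≡ length T → Match d U T (matchCost d U T)
  matchCost-match []       []       _  = nil
  matchCost-match (u ∷ us) (t ∷ ts) eq =
    minList-map (picks (t ∷ ts)) (here refl) (Match d (u ∷ us) (t ∷ ts)) λ { (v , vs) h →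
      let p = picks-sound (t ∷ ts) h in
      add u v ↭-refl p (matchCost-match us vs (ℕ.suc-injective (trans eq (↭-length p)))) }

  -- The partner of the head of `U` in the given matching is among the `picks` of `T`, so the
  -- expansion along that head covers this matching.
  matchCost-≤ : ∀ U {T c} → Match d U T c → matchCost d U T ≤ c
  matchCost-≤ [] m with match-[] m
  ... | refl , refl = ≤-refl
  matchCost-≤ (u ∷ us) {T} m with match-left m ↭-refl
  ... | t , S , b , pT , m′ , refl with picks-complete (∈-resp-↭ (↭-sym pT) (here refl))
  ...   | S′ , h = ≤-trans (minList-≤ (∈-map⁺ _ h))
    (+-monoʳ-≤ (d u t) (matchCost-≤ us
      (match-resp ↭-refl (drop-∷ (↭-trans (↭-sym pT) (picks-sound T h))) m′)))

  matchCost-↭ : ∀ {U U′ T} → length U ≡ length T → U ↭ U′ → matchCost d U T ≡ matchCost d U′ T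
  matchCost-↭ {U} {U′} {T} eq p = ≤-antisym
    (matchCost-≤ U (match-resp (↭-sym p) ↭-refl (matchCost-match U′ T (trans (sym (↭-length p)) eq))))
    (matchCost-≤ U′ (match-resp p ↭-refl (matchCost-match U T eq)))

  matchCost-sym : (∀ x y → d x y ≡ d y x) → ∀ U T → length U ≡ length T →
    matchCost d U T ≤ matchCost d T U
  matchCost-sym d-sym U T eq =
    matchCost-≤ U (flip (matchCost-match T U (sym eq)))
    where
    flip : ∀ {U T c} → Match d U T c → Match d T U c
    flip nil               = nil
    flip (add {c = c} u t pU pT m) =
      subst (λ a → Match d _ _ (a + c)) (d-sym t u) (add t u pT pU (flip m))

  matchCost-triangle : (∀ x y z → d x z ≤ d x y + d y z) → ∀ U V W →
    length U ≡ length V → length V ≡ length W →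
    matchCost d U W ≤ matchCost d U V + matchCost d V W
  matchCost-triangle tri U V W eq eq′
    with match-triangle tri (matchCost-match U V eq) (matchCost-match V W eq′)
  ... | a , m , a≤ = ≤-trans (matchCost-≤ U m) a≤

  matchCost-nonneg : (∀ x y → 0ℚ ≤ d x y) → ∀ U T → length U ≡ length T → 0ℚ ≤ matchCost d U T
  matchCost-nonneg 0≤d U T eq = match-nonneg 0≤d (matchCost-match U T eq)

  -- Exchange between two optimal matchings gives matchings of the rearranged lists with the same
  -- total cost, and optimal ones cost no more.
  matchCost-fourPoint : ∀ Z T → suc (suc (length Z)) ≡ length T →
    FourPoint (λ x y → matchCost d (x ∷ y ∷ Z) T)
  matchCost-fourPoint Z T eq x y u v
    with exchange (length Z) refl (matchCost-match (x ∷ y ∷ Z) T eq) (matchCost-match (u ∷ v ∷ Z) T eq)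
  ... | a , b , sum , inj₁ (m₁ , m₂) =
    inj₁ (≤-trans (+-mono-≤ (matchCost-≤ (u ∷ y ∷ Z) m₁) (matchCost-≤ (x ∷ v ∷ Z) m₂)) (≤-reflexive sum))
  ... | a , b , sum , inj₂ (m₁ , m₂) =
    inj₂ (≤-trans (+-mono-≤ (matchCost-≤ (v ∷ y ∷ Z) m₁) (matchCost-≤ (x ∷ u ∷ Z) m₂)) (≤-reflexive sum))

-- Expectations over independent draws.

-- Unlike `expectIID`, this allows a separate law for each draw, so that laws can be changed a few
-- at a time.
indep : ∀ {n} → List (Fin n → ℚ) → (List (Fin n) → ℚ) → ℚ
indep []       f = f []
indep (p ∷ ps) f = ∑ λ x → p x * indep ps (λ xs → f (x ∷ xs))

module _ {n : ℕ} where

  Weight : Set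
  Weight = Fin n → ℚ

  indep-replicate : ∀ k (p : Weight) f → indep (replicate k p) f ≡ expectIID p k f
  indep-replicate zero    p f = refl
  indep-replicate (suc k) p f = trans
    (∑-cong λ x → cong (p x *_) (indep-replicate k p (λ xs → f (x ∷ xs)))) (∑≡sumFin _)

  indep-cong : ∀ (ps : List Weight) {f g} → (∀ xs → length xs ≡ length ps → f xs ≡ g xs) →
    indep ps f ≡ indep ps g
  indep-cong []       f≗g = f≗g [] refl
  indep-cong (p ∷ ps) f≗g =
    ∑-cong λ x → cong (p x *_) (indep-cong ps λ xs eq → f≗g (x ∷ xs) (cong suc eq))

  indep-mono : ∀ {ps : List Weight} → All IsProb ps → ∀ {f g} →
    (∀ xs → length xs ≡ length ps → f xs ≤ g xs) → indep ps f ≤ indep ps g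
  indep-mono []         f≤g = f≤g [] refl
  indep-mono (pr ∷ prs) f≤g = ∑-mono λ x → *-mono-nonneg (IsProb.nonneg pr x)
    (indep-mono prs λ xs eq → f≤g (x ∷ xs) (cong suc eq))

  indep-+ : ∀ (ps : List Weight) f g →
    indep ps (λ xs → f xs + g xs) ≡ indep ps f + indep ps g
  indep-+ []       f g = refl
  indep-+ (p ∷ ps) f g = trans
    (∑-cong λ x → trans (cong (p x *_) (indep-+ ps (λ xs → f (x ∷ xs)) (λ xs → g (x ∷ xs))))
                        (*-distribˡ-+ (p x) _ _))
    (∑-+ _ _)

  indep-*ˡ : ∀ (ps : List Weight) c f → indep ps (λ xs → c * f xs) ≡ c * indep ps f
  indep-*ˡ []       c f = refl
  indep-*ˡ (p ∷ ps) c f = trans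
    (∑-cong λ x → trans (cong (p x *_) (indep-*ˡ ps c (λ xs → f (x ∷ xs))))
      (solve 3 (λ p c z → p :* (c :* z) := c :* (p :* z)) refl (p x) c (indep ps (λ xs → f (x ∷ xs)))))
    (∑-*ˡ c _)

  indep-∑ : ∀ (ps : List Weight) {m} (f : Fin m → List (Fin n) → ℚ) →
    indep ps (λ xs → ∑ λ i → f i xs) ≡ ∑ λ i → indep ps (f i)
  indep-∑ []       f = refl
  indep-∑ (p ∷ ps) f = trans
    (∑-cong λ x → trans (cong (p x *_) (indep-∑ ps (λ i xs → f i (x ∷ xs)))) (sym (∑-*ˡ (p x) _)))
    (∑-swap (λ x i → p x * indep ps (λ xs → f i (x ∷ xs))))

  indep-swap : ∀ (ps qs : List Weight) (f : List (Fin n) → List (Fin n) → ℚ) →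
    indep ps (λ xs → indep qs (f xs)) ≡ indep qs (λ ys → indep ps (λ xs → f xs ys))
  indep-swap []       qs f = refl
  indep-swap (p ∷ ps) qs f = trans
    (∑-cong λ x → trans (cong (p x *_) (indep-swap ps qs (λ xs → f (x ∷ xs))))
                        (sym (indep-*ˡ qs (p x) _)))
    (sym (indep-∑ qs _))

  indep-const : ∀ {ps : List Weight} → All IsProb ps → ∀ c → indep ps (λ _ → c) ≡ c
  indep-const []                      c = refl
  indep-const {ps = p ∷ ps} (pr ∷ prs) c = trans
    (∑-cong λ x → cong (p x *_) (indep-const prs c))
    (trans (∑-*ʳ c p) (trans (cong (_* c) (trans (∑≡sumFin p) (IsProb.total pr))) (*-identityˡ c)))

  indep-++ : ∀ (ps qs : List Weight) f →
    indep (ps ++ qs) f ≡ indep ps (λ xs → indep qs (λ ys → f (xs ++ ys)))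
  indep-++ []       qs f = refl
  indep-++ (p ∷ ps) qs f = ∑-cong λ x → cong (p x *_) (indep-++ ps qs (λ xs → f (x ∷ xs)))

  indep-congʷ : ∀ {p q : Weight} ps f → (∀ x → p x ≡ q x) → indep (p ∷ ps) f ≡ indep (q ∷ ps) f
  indep-congʷ ps f p≗q = ∑-cong λ x → cong (_* indep ps (λ xs → f (x ∷ xs))) (p≗q x)

  -- The length is fixed because `matchCost` is not invariant under permutations when its first list
  -- is longer than the second.
  Symmetric : ℕ → (List (Fin n) → ℚ) → Set
  Symmetric k f = ∀ {xs ys} → length xs ≡ k → xs ↭ ys → f xs ≡ f ys

  -- Exchanging two laws exchanges two sums, and the symmetry of `f` restores the order of the
  -- arguments.
  indep-↭ : ∀ {ps qs : List Weight} {f} → Symmetric (length ps) f → ps ↭ qs →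
    indep ps f ≡ indep qs f
  indep-↭ f-sym _↭_.refl = refl
  indep-↭ f-sym (_↭_.prep p ps↭qs) = ∑-cong λ x →
    cong (p x *_) (indep-↭ (λ eq xs↭ys → f-sym (cong suc eq) (prep x xs↭ys)) ps↭qs)
  indep-↭ {f = f} f-sym (_↭_.swap {ps} {qs} p q ps↭qs) = begin
    ∑ (λ x → p x * ∑ (λ y → q y * indep ps (λ xs → f (x ∷ y ∷ xs))))
      ≡⟨ ∑-cong (λ x → sym (∑-*ˡ (p x) _)) ⟩
    ∑ (λ x → ∑ (λ y → p x * (q y * indep ps (λ xs → f (x ∷ y ∷ xs)))))
      ≡⟨ ∑-swap _ ⟩
    ∑ (λ y → ∑ (λ x → p x * (q y * indep ps (λ xs → f (x ∷ y ∷ xs)))))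
      ≡⟨ ∑-cong (λ y → ∑-cong λ x → trans
           (cong (λ z → p x * (q y * z)) (tails x y))
           (solve 3 (λ p q z → p :* (q :* z) := q :* (p :* z)) refl (p x) (q y)
                  (indep qs (λ xs → f (y ∷ x ∷ xs))))) ⟩
    ∑ (λ y → ∑ (λ x → q y * (p x * indep qs (λ xs → f (y ∷ x ∷ xs)))))
      ≡⟨ ∑-cong (λ y → ∑-*ˡ (q y) _) ⟩
    ∑ (λ y → q y * ∑ (λ x → p x * indep qs (λ xs → f (y ∷ x ∷ xs)))) ∎
    where
    open ≡-Reasoning
    tails : ∀ x y → indep ps (λ xs → f (x ∷ y ∷ xs)) ≡ indep qs (λ xs → f (y ∷ x ∷ xs))
    tails x y = trans
      (indep-cong ps λ xs eq → f-sym (cong (2 ℕ.+_) eq) (↭-swap₂ x y ↭-refl))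
      (indep-↭ (λ eq xs↭ys → f-sym (cong (2 ℕ.+_) eq) (prep y (prep x xs↭ys))) ps↭qs)
  indep-↭ f-sym (_↭_.trans p q) = trans (indep-↭ f-sym p)
    (indep-↭ (λ eq → f-sym (trans eq (sym (↭-length p)))) q)

  -- Bringing two laws closer together.

  form-linearˡ : ∀ (E E′ F : Weight) c g →
    form (λ x → E x + c * E′ x) F g ≡ form E F g + c * form E′ F g
  form-linearˡ E E′ F c g = trans
    (∑-cong λ x → solve 4 (λ e c e′ z → (e :+ c :* e′) :* z := e :* z :+ c :* (e′ :* z)) refl
                        (E x) c (E′ x) (∑ λ y → F y * g x y))
    (trans (∑-+ _ _) (cong (_+_ (form E F g)) (∑-*ˡ c _)))

  form-flip : ∀ (E F : Weight) g → form E F g ≡ form F E (λ x y → g y x)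
  form-flip E F g = trans (∑-cong λ x → sym (∑-*ˡ (E x) _)) (trans (∑-swap _)
    (∑-cong λ y → trans (∑-cong λ x →
        solve 3 (λ e f z → e :* (f :* z) := f :* (e :* z)) refl (E x) (F y) (g x y))
      (∑-*ˡ (F y) _)))

  form-linearʳ : ∀ (E F F′ : Weight) c g →
    form E (λ x → F x + c * F′ x) g ≡ form E F g + c * form E F′ g
  form-linearʳ E F F′ c g = trans (form-flip E (λ x → F x + c * F′ x) g)
    (trans (form-linearˡ F F′ E c (λ x y → g y x))
      (sym (cong₂ (λ p q → p + c * q) (form-flip E F g) (form-flip E F′ g))))

  infixl 6 _⊕_·_
  _⊕_·_ : Weight → ℚ → Weight → Weight
  (p ⊕ c · E) x = p x + c * E x

  -- Both pairs of weights have the same sum, so the terms in `bb` and `bE` cancel and only a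
  -- multiple of `EE` is left.
  form-spread : ∀ (b E : Weight) c g → (∀ x y → g x y ≡ g y x) → 0ℚ ≤ 1ℚ + c → 0ℚ ≤ form E E g →
    form (b ⊕ (1ℚ + c) · E) (b ⊕ (- 1ℚ) · E) g ≤ form (b ⊕ c · E) b g
  form-spread b E c g g-sym 0≤1+c 0≤EE = 0≤q-p⇒p≤q (subst (0ℚ ≤_) (sym difference) (0≤* 0≤1+c 0≤EE))
    where
    bb = form b b g
    bE = form b E g
    EE = form E E g
    Eb : form E b g ≡ bE
    Eb = trans (form-flip E b g) (form-cong b E (λ x y → g-sym y x))
    wide : form (b ⊕ (1ℚ + c) · E) (b ⊕ (- 1ℚ) · E) g ≡
           (bb + (- 1ℚ) * bE) + (1ℚ + c) * (bE + (- 1ℚ) * EE)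
    wide = trans (form-linearˡ b E (b ⊕ (- 1ℚ) · E) (1ℚ + c) g)
      (cong₂ (λ p q → p + (1ℚ + c) * q) (form-linearʳ b b E (- 1ℚ) g)
        (trans (form-linearʳ E b E (- 1ℚ) g) (cong (_+ (- 1ℚ) * EE) Eb)))
    narrow : form (b ⊕ c · E) b g ≡ bb + c * bE
    narrow = trans (form-linearˡ b E b c g) (cong (λ z → bb + c * z) Eb)
    difference : form (b ⊕ c · E) b g - form (b ⊕ (1ℚ + c) · E) (b ⊕ (- 1ℚ) · E) g ≡ (1ℚ + c) * EE
    difference = trans (cong₂ _-_ narrow wide)
      (solve 4 (λ p q r c → (p :+ c :* q) :-
            ((p :+ con (- 1ℚ) :* q) :+ (con 1ℚ :+ c) :* (q :+ con (- 1ℚ) :* r)) :=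
          (con 1ℚ :+ c) :* r) refl bb bE EE c)

  -- Two arguments vary while the other points `Z` are fixed. Total 0 is the relevant case, since
  -- `E` will be a difference of two distributions.
  record Dispersive (k : ℕ) (f : List (Fin n) → ℚ) : Set where
    field
      symmetric : Symmetric k f
      psd       : ∀ Z → suc (suc (length Z)) ≡ k → ∀ E → ∑ E ≡ 0ℚ →
                  0ℚ ≤ form E E (λ x y → f (x ∷ y ∷ Z))

  open Dispersive

  dispersive-∷ : ∀ {k f} x → Dispersive (suc k) f → Dispersive k (λ xs → f (x ∷ xs))
  dispersive-∷ x D .symmetric eq p = symmetric D (cong suc eq) (prep x p)
  dispersive-∷ {f = f} w D .psd Z eq E ∑E≡0 = subst (0ℚ ≤_)
    (form-cong E E λ x y → symmetric D (cong suc eq) (↭-sym (front x y)))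
    (psd D (w ∷ Z) (cong suc eq) E ∑E≡0)
    where
    front : ∀ x y → w ∷ x ∷ y ∷ Z ↭ x ∷ y ∷ w ∷ Z
    front x y = ↭-trans (↭-swap₂ w x ↭-refl) (prep x (↭-swap₂ w y ↭-refl))

  form-indep : ∀ (ps : List Weight) E F (f : Fin n → Fin n → List (Fin n) → ℚ) →
    form E F (λ x y → indep ps (f x y)) ≡ indep ps (λ xs → form E F (λ x y → f x y xs))
  form-indep ps E F f = sym (trans (indep-∑ ps _)
    (∑-cong λ x → trans (indep-*ˡ ps (E x) _) (cong (E x *_) (trans (indep-∑ ps _)
      (∑-cong λ y → indep-*ˡ ps (F y) _)))))

  -- Apply `form-spread` to the kernel averaged over the remaining draws. Its form is the average of
  -- the forms, hence nonnegative.
  indep-spread : ∀ {ps f} (b E : Weight) c → Dispersive (suc (suc (length ps))) f → All IsProb ps →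
    0ℚ ≤ 1ℚ + c → ∑ E ≡ 0ℚ →
    indep (b ⊕ (1ℚ + c) · E ∷ b ⊕ (- 1ℚ) · E ∷ ps) f ≤ indep (b ⊕ c · E ∷ b ∷ ps) f
  indep-spread {ps} {f} b E c D prs 0≤1+c ∑E≡0 =
    form-spread b E c (λ x y → indep ps (λ xs → f (x ∷ y ∷ xs)))
      (λ x y → indep-cong ps λ xs eq → symmetric D (cong (2 ℕ.+_) eq) (↭-swap₂ x y ↭-refl))
      0≤1+c
      (subst₂ _≤_ (indep-const prs 0ℚ) (sym (form-indep ps E E (λ x y xs → f (x ∷ y ∷ xs))))
        (indep-mono prs λ xs eq → psd D xs (cong (2 ℕ.+_) eq) E ∑E≡0))

-- Natural numbers as rationals.

-- Defined by recursion so that it unfolds along inductions on the number of draws; `ι≡/1` links it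
-- to the fractions of the statement.
ι : ℕ → ℚ
ι zero    = 0ℚ
ι (suc m) = 1ℚ + ι m

0≤1 : 0ℚ ≤ 1ℚ
0≤1 = nonNegative⁻¹ 1ℚ

0≤ι : ∀ m → 0ℚ ≤ ι m
0≤ι zero    = ≤-refl
0≤ι (suc m) = 0≤+ 0≤1 (0≤ι m)

0<ι : ∀ m → 0ℚ < ι (suc m)
0<ι m = <-≤-trans (positive⁻¹ 1ℚ) (subst (_≤ 1ℚ + ι m) (+-identityʳ 1ℚ) (+-monoʳ-≤ 1ℚ (0≤ι m)))

-- Replacing all laws by their average.

module _ {n : ℕ} where

  open Dispersive

  ∑-prob : {p : Weight {n}} → IsProb p → ∑ p ≡ 1ℚ
  ∑-prob {p} pr = trans (∑≡sumFin p) (IsProb.total pr)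

  isProb-cong : {p q : Weight {n}} → (∀ x → p x ≡ q x) → IsProb p → IsProb q
  isProb-cong {p} {q} p≗q pr = record
    { nonneg = λ x → subst (0ℚ ≤_) (p≗q x) (IsProb.nonneg pr x)
    ; total  = trans (sym (∑≡sumFin q)) (trans (sym (∑-cong p≗q)) (∑-prob pr)) }

  -- The excess of the first law is used up one unit at a time: each step turns one copy of
  -- `b ⊕ (- 1ℚ) · E` into `b`, which then moves into `qs`.
  indep-merge : ∀ j {k qs f} (b E : Weight {n}) → k ≡ suc (j ℕ.+ length qs) → Dispersive k f →
    IsProb (b ⊕ (- 1ℚ) · E) → IsProb b → All IsProb qs → ∑ E ≡ 0ℚ →
    indep (b ⊕ ι j · E ∷ replicate j (b ⊕ (- 1ℚ) · E) ++ qs) f ≤ indep (b ∷ replicate j b ++ qs) f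
  indep-merge zero {qs = qs} {f} b E refl D prₐ pr prs ∑E≡0 = ≤-reflexive
    (indep-congʷ qs f λ x → trans (cong (_+_ (b x)) (*-zeroˡ (E x))) (+-identityʳ (b x)))
  indep-merge (suc j) {qs = qs} {f} b E refl D prₐ pr prs ∑E≡0 = begin
    indep (b ⊕ ι (suc j) · E ∷ a ∷ replicate j a ++ qs) f
      ≤⟨ indep-spread b E (ι j)
           (subst (λ l → Dispersive (2 ℕ.+ l) f) (sym (length-tail a)) D)
           (All.++⁺ (All.replicate⁺ j prₐ) prs) (0≤ι (suc j)) ∑E≡0 ⟩
    indep (b ⊕ ι j · E ∷ b ∷ replicate j a ++ qs) f
      ≡⟨ indep-↭ (subst (λ l → Symmetric (2 ℕ.+ l) f) (sym (length-tail a)) (symmetric D))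
           (prep (b ⊕ ι j · E) (↭-sym (shift b (replicate j a) qs))) ⟩
    indep (b ⊕ ι j · E ∷ replicate j a ++ b ∷ qs) f
      ≤⟨ indep-merge j b E (cong suc (sym (ℕ.+-suc j (length qs)))) D prₐ pr (pr ∷ prs) ∑E≡0 ⟩
    indep (b ∷ replicate j b ++ b ∷ qs) f
      ≡⟨ sym (indep-↭ (subst (λ l → Symmetric (2 ℕ.+ l) f) (sym (length-tail b)) (symmetric D))
           (prep b (↭-sym (shift b (replicate j b) qs)))) ⟩
    indep (b ∷ b ∷ replicate j b ++ qs) f ∎
    where
    open ≤-Reasoning
    a = b ⊕ (- 1ℚ) · E
    length-tail : ∀ (c : Weight) → length (replicate j c ++ qs) ≡ j ℕ.+ length qs
    length-tail c = trans (length-++ (replicate j c)) (cong (ℕ._+ length qs) (length-replicate j))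

  total : List (Weight {n}) → Weight {n}
  total []       x = 0ℚ
  total (p ∷ ps) x = p x + total ps x

  ∑-total : ∀ {ps} → All IsProb ps → ∑ (total ps) ≡ ι (length ps)
  ∑-total []         = ∑-0
  ∑-total (pr ∷ prs) = trans (∑-+ _ _) (cong₂ _+_ (∑-prob pr) (∑-total prs))

  total-nonneg : ∀ {ps} → All IsProb ps → ∀ x → 0ℚ ≤ total ps x
  total-nonneg []         x = ≤-refl
  total-nonneg (pr ∷ prs) x = 0≤+ (IsProb.nonneg pr x) (total-nonneg prs x)

  average : ∀ {p ps} → All IsProb (p ∷ ps) →
    ∃ λ a → IsProb a × ∀ x → ι (suc (length ps)) * a x ≡ total (p ∷ ps) x
  average {p} {ps} prs = (λ x → r * total (p ∷ ps) x) ,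
    record { nonneg = λ x → 0≤* 0≤r (total-nonneg prs x)
           ; total  = trans (sym (∑≡sumFin _)) (trans (∑-*ˡ r (total (p ∷ ps)))
                        (trans (cong (r *_) (∑-total prs)) (*-inverseˡ m))) } ,
    λ x → trans (sym (*-assoc m r (total (p ∷ ps) x)))
                (trans (cong (_* total (p ∷ ps) x) (*-inverseʳ m)) (*-identityˡ (total (p ∷ ps) x)))
    where
    m = ι (suc (length ps))
    instance
      m-pos = positive (0<ι (length ps))
      m-nonZero = pos⇒nonZero m
    r = 1/ m
    0≤r : 0ℚ ≤ r
    0≤r = <⇒≤ (positive⁻¹ r {{1/pos⇒pos m}})

  -- By induction, with the first point fixed, the other `m` laws are replaced by their mean `a₀`.
  -- For `E` the difference of `a` and `a₀`, the first law is `a ⊕ ι m · E` and each other one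
  -- `a ⊕ (- 1ℚ) · E`, which `indep-merge` levels.
  indep≤iid : ∀ ps {f} a → Dispersive (length ps) f → All IsProb ps → IsProb a →
    (∀ x → ι (length ps) * a x ≡ total ps x) → indep ps f ≤ indep (replicate (length ps) a) f
  indep≤iid [] a D prs prₐ avg = ≤-refl
  -- Treated apart, since an empty tail has no mean.
  indep≤iid (p ∷ []) {f} a D prs prₐ avg = ≤-reflexive (indep-congʷ [] f λ x →
    trans (sym (+-identityʳ (p x))) (trans (sym (avg x))
      (trans (cong (_* a x) (+-identityʳ 1ℚ)) (*-identityˡ (a x)))))
  indep≤iid (p ∷ ps@(_ ∷ _)) {f} a D (pr ∷ prs) prₐ avg with average prs
  ... | a₀ , pr₀ , avg₀ = begin
    indep (p ∷ ps) f
      ≤⟨ ∑-mono (λ x → *-mono-nonneg (IsProb.nonneg pr x)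
           (indep≤iid ps a₁ (dispersive-∷ x D) prs pr₁ avg₁)) ⟩
    indep (p ∷ replicate m a₁) f
      ≡⟨ indep-congʷ (replicate m a₁) f p≗ ⟩
    indep (a ⊕ ι m · E ∷ replicate m a₁) f
      ≡⟨ cong (λ qs → indep (a ⊕ ι m · E ∷ qs) f) (sym (++-identityʳ (replicate m a₁))) ⟩
    indep (a ⊕ ι m · E ∷ replicate m a₁ ++ []) f
      ≤⟨ indep-merge m a E (cong suc (sym (ℕ.+-identityʳ m))) D pr₁ prₐ [] ∑E≡0 ⟩
    indep (a ∷ replicate m a ++ []) f
      ≡⟨ cong (λ qs → indep (a ∷ qs) f) (++-identityʳ (replicate m a)) ⟩
    indep (a ∷ replicate m a) f ∎
    where
    open ≤-Reasoning
    m = length ps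
    E a₁ : Weight
    E  = a ⊕ (- 1ℚ) · a₀
    -- Pointwise this is `a₀`, in the shape that `indep-merge` takes.
    a₁ = a ⊕ (- 1ℚ) · E
    a₀≗a₁ : ∀ x → a₀ x ≡ a₁ x
    a₀≗a₁ x = solve 2 (λ a a₀ → a₀ := a :+ con (- 1ℚ) :* (a :+ con (- 1ℚ) :* a₀)) refl (a x) (a₀ x)
    pr₁ : IsProb a₁
    pr₁ = isProb-cong a₀≗a₁ pr₀
    avg₁ : ∀ x → ι m * a₁ x ≡ total ps x
    avg₁ x = trans (cong (ι m *_) (sym (a₀≗a₁ x))) (avg₀ x)
    p≗ : ∀ x → p x ≡ (a ⊕ ι m · E) x
    p≗ x = begin-equality
      p x                                         ≡⟨ solve 2 (λ p t → p := (p :+ t) :- t) refl (p x) (total ps x) ⟩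
      (p x + total ps x) - total ps x             ≡⟨ cong₂ _-_ (sym (avg x)) (sym (avg₀ x)) ⟩
      (1ℚ + ι m) * a x - ι m * a₀ x
        ≡⟨ solve 3 (λ m a a₀ → (con 1ℚ :+ m) :* a :- m :* a₀ := a :+ m :* (a :+ con (- 1ℚ) :* a₀))
                 refl (ι m) (a x) (a₀ x) ⟩
      a x + ι m * (a x + (- 1ℚ) * a₀ x)           ∎
    ∑E≡0 : ∑ E ≡ 0ℚ
    ∑E≡0 = trans (∑-+ a (λ x → (- 1ℚ) * a₀ x))
      (trans (cong (_+_ (∑ a)) (∑-*ˡ (- 1ℚ) a₀)) (cong₂ (λ p q → p + (- 1ℚ) * q) (∑-prob prₐ) (∑-prob pr₀)))

-- Floors, fractions and inverses.

ι-+ : ∀ m n → ι (m ℕ.+ n) ≡ ι m + ι n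
ι-+ zero    n = sym (+-identityˡ (ι n))
ι-+ (suc m) n = trans (cong (_+_ 1ℚ) (ι-+ m n)) (sym (+-assoc 1ℚ (ι m) (ι n)))

ι-cancel-≤ : ∀ {m n} → ι m ≤ ι n → m ℕ.≤ n
ι-cancel-≤ {m} {n} ιm≤ιn with m ℕ.≤? n
... | yes m≤n = m≤n
... | no  m≰n with ℕ.m≤n⇒∃[o]m+o≡n (ℕ.≰⇒> m≰n)
...   | o , refl = ⊥-elim (<-irrefl refl (<-≤-trans
  (subst₂ _<_ (+-identityʳ (ι n)) (trans (sym (ι-+ n (suc o))) (cong ι (ℕ.+-suc n o)))
          (+-monoʳ-< (ι n) (0<ι o)))
  ιm≤ιn))

toℚᵘ-ι : ∀ m → toℚᵘ (ι m) ℚᵘ.≃ mkℚᵘ (+ m) 0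
toℚᵘ-ι zero    = ℚᵘ.≃-refl
toℚᵘ-ι (suc m) = ℚᵘ.≃-trans (toℚᵘ-homo-+ 1ℚ (ι m))
  (ℚᵘ.≃-trans (ℚᵘ.+-congʳ ℚᵘ.1ℚᵘ (toℚᵘ-ι m))
    (ℚᵘ.*≡* (cong (ℤ._* + 1) (cong (ℤ._+_ (+ 1)) (ℤ.*-identityʳ (+ m))))))

ι≡/1 : ∀ m → ι m ≡ + m / 1
ι≡/1 m = toℚᵘ-injective (ℚᵘ.≃-trans (toℚᵘ-ι m) (ℚᵘ.≃-sym (toℚᵘ-fromℚᵘ (mkℚᵘ (+ m) 0))))

ι*/ : ∀ k .{{_ : NonZero k}} c → ι k * (+ c / k) ≡ ι c
ι*/ (suc k) c = toℚᵘ-injective (ℚᵘ.≃-trans (toℚᵘ-homo-* (ι (suc k)) (+ c / suc k))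
  (ℚᵘ.≃-trans (ℚᵘ.*-cong (toℚᵘ-ι (suc k)) (toℚᵘ-fromℚᵘ (mkℚᵘ (+ c) k)))
    (ℚᵘ.≃-trans (ℚᵘ.*≡* cross) (ℚᵘ.≃-sym (toℚᵘ-ι c)))))
  where
  cross : + suc k ℤ.* + c ℤ.* + 1 ≡ + c ℤ.* + suc (k ℕ.+ 0)
  cross = trans (ℤ.*-identityʳ (+ suc k ℤ.* + c))
    (trans (ℤ.*-comm (+ suc k) (+ c)) (cong (λ l → + c ℤ.* + suc l) (sym (ℕ.+-identityʳ k))))

-- The floor of a nonnegative `r` is a natural quotient, so the absolute value, taken also in `cnt`,
-- does not alter it.
floor-≤ : ∀ r → 0ℚ ≤ r → ι ℤ.∣ floor r ∣ ≤ r
floor-≤ r@(mkℚ (+ a) d _) 0≤r = toℚᵘ-cancel-≤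
  (ℚᵘ.≤-respˡ-≃ (ℚᵘ.≃-sym (toℚᵘ-ι ℤ.∣ floor r ∣)) (ℚᵘ.*≤*
    (subst₂ ℤ._≤_ (ℤ.pos-* ℤ.∣ floor r ∣ (suc d)) (sym (ℤ.*-identityʳ (+ a)))
      (ℤ.+≤+ (subst (λ z → ℤ.∣ z ∣ ℕ.* suc d ℕ.≤ a) (sym (ℤ.*-identityˡ (+ (a ℕ./ suc d))))
        (m/n*n≤m a (suc d)))))))
floor-≤ (mkℚ (-[1+ a ]) d _) (*≤* ())

inv-nonneg : ∀ {p} → 0ℚ ≤ p → 0ℚ ≤ inv p
inv-nonneg {mkℚ (+ zero) _ _}      0≤p = ≤-refl
inv-nonneg {p@(mkℚ (+ suc _) _ _)} 0≤p = <⇒≤ (positive⁻¹ (1/ p) {{1/pos⇒pos p}})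
inv-nonneg {mkℚ -[1+ _ ] _ _}      (*≤* ())

*-inv : ∀ {p} → p ≢ 0ℚ → p * inv p ≡ 1ℚ
*-inv {p@(mkℚ (+ zero) _ _)}   p≢0 = ⊥-elim (p≢0 (↥p≡0⇒p≡0 p refl))
*-inv {p@(mkℚ (+ suc _) _ _)}  p≢0 = *-inverseʳ p
*-inv {p@(mkℚ -[1+ _ ] _ _)}   p≢0 = *-inverseʳ p


-- Point masses and lists of copies.

∑-suc : ∀ {n} (f : Fin (suc n) → ℚ) → ∑ f ≡ f zero + ∑ (f ∘ suc)
∑-suc f = ∑-remove zero f

∑-single : ∀ {n} (i : Fin n) (f : Fin n → ℚ) → (∀ j → i ≢ j → f j ≡ 0ℚ) → ∑ f ≡ f i
∑-single {suc n} i f f≡0 = trans (∑-remove i f) (trans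
  (cong (_+_ (f i)) (trans (∑-cong λ j → f≡0 (punchIn i j) (punchInᵢ≢i i j ∘ sym)) ∑-0))
  (+-identityʳ (f i)))

≤∑ : ∀ {n} (f : Fin n → ℚ) → (∀ j → 0ℚ ≤ f j) → ∀ i → f i ≤ ∑ f
≤∑ {suc n} f 0≤f i = subst₂ _≤_ (+-identityʳ (f i)) (sym (∑-remove i f))
  (+-monoʳ-≤ (f i) (0≤∑ (0≤f ∘ punchIn i)))

δ : ∀ {n} → Fin n → Fin n → ℚ
δ x y with x ≟ᶠ y
... | yes _ = 1ℚ
... | no  _ = 0ℚ

δ-refl : ∀ {n} (x : Fin n) → δ x x ≡ 1ℚ
δ-refl x with x ≟ᶠ x
... | yes _   = refl
... | no  x≢x = ⊥-elim (x≢x refl)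

δ-≢ : ∀ {n} {x y : Fin n} → x ≢ y → δ x y ≡ 0ℚ
δ-≢ {x = x} {y} x≢y with x ≟ᶠ y
... | yes x≡y = ⊥-elim (x≢y x≡y)
... | no  _   = refl

∑-δ : ∀ {n} (x : Fin n) (f : Fin n → ℚ) → ∑ (λ y → δ x y * f y) ≡ f x
∑-δ x f = trans (∑-single x (λ y → δ x y * f y) λ y x≢y → trans (cong (_* f y) (δ-≢ x≢y)) (*-zeroˡ (f y)))
  (trans (cong (_* f x) (δ-refl x)) (*-identityˡ (f x)))

δ-prob : ∀ {n} (x : Fin n) → IsProb (δ x)
δ-prob x = record { nonneg = 0≤δ ; total = trans (sym (∑≡sumFin (δ x)))
                      (trans (∑-single x (δ x) λ y x≢y → δ-≢ x≢y) (δ-refl x)) }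
  where
  0≤δ : ∀ y → 0ℚ ≤ δ x y
  0≤δ y with x ≟ᶠ y
  ... | yes _ = 0≤1
  ... | no  _ = ≤-refl

module _ {n : ℕ} where

  indep-δ : ∀ (xs : List (Fin n)) f → indep (map δ xs) f ≡ f xs
  indep-δ []       f = refl
  indep-δ (x ∷ xs) f = trans (∑-δ x (λ y → indep (map δ xs) (λ ys → f (y ∷ ys)))) (indep-δ xs (λ ys → f (x ∷ ys)))

  total-++ : ∀ (ps qs : List (Weight {n})) x → total (ps ++ qs) x ≡ total ps x + total qs x
  total-++ []       qs x = sym (+-identityˡ (total qs x))
  total-++ (p ∷ ps) qs x = trans (cong (_+_ (p x)) (total-++ ps qs x))
    (sym (+-assoc (p x) (total ps x) (total qs x)))

  total-replicate : ∀ c (p : Weight {n}) x → total (replicate c p) x ≡ ι c * p x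
  total-replicate zero    p x = sym (*-zeroˡ (p x))
  total-replicate (suc c) p x = trans (cong (_+_ (p x)) (total-replicate c p x))
    (solve 2 (λ p c → p :+ c :* p := (con 1ℚ :+ c) :* p) refl (p x) (ι c))

  -- Stated for any `h` because `allFin n` is `tabulate id` and the induction passes from `h` to
  -- `h ∘ suc`.
  total-copies : ∀ {m} (c : Fin n → ℕ) (h : Fin m → Fin n) x →
    total (map δ (concatMap (λ y → replicate (c y) y) (tabulate h))) x ≡
    ∑ (λ i → ι (c (h i)) * δ (h i) x)
  total-copies {zero}  c h x = sym (∑-empty _)
  total-copies {suc m} c h x = begin
    total (map δ (replicate (c (h zero)) (h zero) ++ copies)) x
      ≡⟨ cong (λ ps → total ps x) (trans (map-++ δ (replicate (c (h zero)) (h zero)) copies)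
           (cong (_++ map δ copies) (map-replicate δ (c (h zero)) (h zero)))) ⟩
    total (replicate (c (h zero)) (δ (h zero)) ++ map δ copies) x
      ≡⟨ total-++ (replicate (c (h zero)) (δ (h zero))) (map δ copies) x ⟩
    total (replicate (c (h zero)) (δ (h zero))) x + total (map δ copies) x
      ≡⟨ cong₂ _+_ (total-replicate (c (h zero)) (δ (h zero)) x) (total-copies c (h ∘ suc) x) ⟩
    ι (c (h zero)) * δ (h zero) x + ∑ (λ i → ι (c (h (suc i))) * δ (h (suc i)) x)
      ≡⟨ sym (∑-suc (λ i → ι (c (h i)) * δ (h i) x)) ⟩
    ∑ (λ i → ι (c (h i)) * δ (h i) x) ∎
    where
    open ≡-Reasoning
    copies = concatMap (λ y → replicate (c y) y) (tabulate (h ∘ suc))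

  length-copies : ∀ {m} (c : Fin n → ℕ) (h : Fin m → Fin n) →
    length (concatMap (λ y → replicate (c y) y) (tabulate h)) ≡ sumFinℕ (c ∘ h)
  length-copies {zero}  c h = refl
  length-copies {suc m} c h = trans (length-++ (replicate (c (h zero)) (h zero)))
    (cong₂ ℕ._+_ (length-replicate (c (h zero))) (length-copies c (h ∘ suc)))

-- The variance-reduced sample as independent draws.

ι-sumFinℕ : ∀ {n} (c : Fin n → ℕ) → ι (sumFinℕ c) ≡ ∑ (ι ∘ c)
ι-sumFinℕ {zero}  c = sym (∑-empty _)
ι-sumFinℕ {suc n} c = trans (ι-+ (c zero) (sumFinℕ (c ∘ suc)))
  (trans (cong (_+_ (ι (c zero))) (ι-sumFinℕ (c ∘ suc))) (sym (∑-suc (ι ∘ c))))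


-- The sampling scheme draws k independent points, the base points from point masses, and the
-- average of their k distributions is P.
module _ {n : ℕ} (P : Fin n → ℚ) (pr : IsProb P) (k : ℕ) .{{_ : NonZero k}} where

  open VarianceReduced P k

  draws : List (Weight {n})
  draws = map δ base ++ replicate rest q

  expectVR≡indep : ∀ f → expectVR P k f ≡ indep draws f
  expectVR≡indep f = sym (trans (indep-++ (map δ base) (replicate rest q) f)
    (trans (indep-δ base _) (indep-replicate rest q (λ ys → f (base ++ ys)))))

  -- Scaled by `k`, the leftover weights are the fractional parts of the `ι k * P x`.
  kw : ∀ x → ι k * w x ≡ ι k * P x - ι (cnt x)
  kw x = trans (solve 3 (λ k p c → k :* (p :- c) := k :* p :- k :* c) refl (ι k) (P x) (+ cnt x / k))
    (cong (λ z → ι k * P x - z) (ι*/ k (cnt x)))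

  cnt≤ : ∀ x → ι (cnt x) ≤ ι k * P x
  cnt≤ x = subst (ι (cnt x) ≤_) (trans (cong (P x *_) (sym (ι≡/1 k))) (*-comm (P x) (ι k)))
    (floor-≤ _ (0≤* (IsProb.nonneg pr x) (subst (0ℚ ≤_) (ι≡/1 k) (0≤ι k))))

  0≤w : ∀ x → 0ℚ ≤ w x
  0≤w x = positive-cancel k (subst (0ℚ ≤_) (sym (kw x)) (0≤q-p (cnt≤ x)))
    where
    positive-cancel : ∀ k .{{_ : NonZero k}} {z} → 0ℚ ≤ ι k * z → 0ℚ ≤ z
    positive-cancel (suc k) {z} h = *-cancelˡ-≤-pos (ι (suc k)) {{positive (0<ι k)}}
      (subst (_≤ ι (suc k) * z) (sym (*-zeroʳ (ι (suc k)))) h)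

  ∑kP : ∑ (λ x → ι k * P x) ≡ ι k
  ∑kP = trans (∑-*ˡ (ι k) P) (trans (cong (ι k *_) (∑-prob pr)) (*-identityʳ (ι k)))

  -- The floors add up to at most the sum of the `ι k * P x`, which is `ι k`; hence the truncated
  -- subtraction in `rest` is exact.
  base-size : sumFinℕ cnt ℕ.+ rest ≡ k
  base-size = ℕ.m+[n∸m]≡n {sumFinℕ cnt} {k} (ι-cancel-≤ {sumFinℕ cnt} {k} (subst₂ _≤_ (sym (ι-sumFinℕ cnt)) ∑kP (∑-mono cnt≤)))

  W : ℚ
  W = ∑ w

  -- Summing `kw`: the random draws are as many as the fractional parts add up to.
  ι-rest : ι rest ≡ ι k * W
  ι-rest = begin
    ι rest
      ≡⟨ solve 2 (λ r N → r := (N :+ r) :- N) refl (ι rest) (ι (sumFinℕ cnt)) ⟩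
    (ι (sumFinℕ cnt) + ι rest) - ι (sumFinℕ cnt)
      ≡⟨ cong₂ _-_ (trans (sym (ι-+ (sumFinℕ cnt) rest)) (cong ι base-size)) (ι-sumFinℕ cnt) ⟩
    ι k - ∑ (ι ∘ cnt)
      ≡⟨ solve 2 (λ k N → k :- N := (k :+ con (- 1ℚ) :* N)) refl (ι k) (∑ (ι ∘ cnt)) ⟩
    ι k + (- 1ℚ) * ∑ (ι ∘ cnt)
      ≡⟨ cong₂ _+_ (sym ∑kP) (sym (∑-*ˡ (- 1ℚ) (ι ∘ cnt))) ⟩
    ∑ (λ x → ι k * P x) + ∑ (λ x → (- 1ℚ) * ι (cnt x))
      ≡⟨ sym (∑-+ _ _) ⟩
    ∑ (λ x → ι k * P x + (- 1ℚ) * ι (cnt x))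
      ≡⟨ ∑-cong (λ x → trans
           (solve 2 (λ p c → p :+ con (- 1ℚ) :* c := p :- c) refl (ι k * P x) (ι (cnt x)))
           (sym (kw x))) ⟩
    ∑ (λ x → ι k * w x)
      ≡⟨ ∑-*ˡ (ι k) w ⟩
    ι k * W ∎
    where open ≡-Reasoning

  q≡ : ∀ x → q x ≡ w x * inv W
  q≡ x = cong (λ s → w x * inv s) (sym (∑≡sumFin w))

  W*q : ∀ x → W * q x ≡ w x
  W*q x = scale (W ≟ 0ℚ)
    where
    scale : Dec (W ≡ 0ℚ) → W * q x ≡ w x
    -- If `W` is 0, so is every `w x`, and the equation survives the default value of `inv`.
    scale (yes W≡0) = trans (cong (_* q x) W≡0) (trans (*-zeroˡ (q x))
      (≤-antisym (0≤w x) (subst (w x ≤_) W≡0 (≤∑ w 0≤w x))))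
    scale (no  W≢0) = trans (cong (W *_) (q≡ x))
      (trans (solve 3 (λ s w i → s :* (w :* i) := w :* (s :* i)) refl W (w x) (inv W))
        (trans (cong (w x *_) (*-inv W≢0)) (*-identityʳ (w x))))

  draws-prob : All IsProb draws
  draws-prob = All.++⁺ (All.map⁺ (All.universal δ-prob base)) (extra (W ≟ 0ℚ))
    where
    extra : Dec (W ≡ 0ℚ) → All IsProb (replicate rest q)
    -- Here `q` is identically 0 and no distribution, but it is never drawn from.
    extra (yes W≡0) = subst (λ r → All IsProb (replicate r q)) (sym rest≡0) []
      where
      rest≡0 : rest ≡ 0
      rest≡0 = ℕ.n≤0⇒n≡0 (ι-cancel-≤ (≤-reflexive
        (trans ι-rest (trans (cong (ι k *_) W≡0) (*-zeroʳ (ι k))))))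
    extra (no  W≢0) = All.replicate⁺ rest record
      { nonneg = λ x → subst (0ℚ ≤_) (sym (q≡ x)) (0≤* (0≤w x) (inv-nonneg (0≤∑ 0≤w)))
      ; total  = trans (sym (∑≡sumFin q))
          (trans (∑-cong q≡) (trans (∑-*ʳ (inv W) w) (*-inv W≢0))) }

  draws-length : length draws ≡ k
  draws-length = trans (length-++ (map δ base)) (trans
    (cong₂ ℕ._+_ (trans (length-map δ base) (length-copies cnt id)) (length-replicate rest))
    base-size)

  -- The expected number of copies of `x` is its floor plus `ι rest * q x`, and the latter is the
  -- fractional part that the floor cut off.
  draws-average : ∀ x → ι k * P x ≡ total draws x
  draws-average x = sym (begin
    total draws x
      ≡⟨ total-++ (map δ base) (replicate rest q) x ⟩
    total (map δ base) x + total (replicate rest q) x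
      ≡⟨ cong₂ _+_ (trans (total-copies cnt id x) copies) (total-replicate rest q x) ⟩
    ι (cnt x) + ι rest * q x
      ≡⟨ cong (λ r → ι (cnt x) + r * q x) ι-rest ⟩
    ι (cnt x) + ι k * W * q x
      ≡⟨ cong (_+_ (ι (cnt x))) (trans (*-assoc (ι k) W (q x)) (cong (ι k *_) (W*q x))) ⟩
    ι (cnt x) + ι k * w x
      ≡⟨ cong (_+_ (ι (cnt x))) (kw x) ⟩
    ι (cnt x) + (ι k * P x - ι (cnt x))
      ≡⟨ solve 2 (λ c p → c :+ (p :- c) := p) refl (ι (cnt x)) (ι k * P x) ⟩
    ι k * P x ∎)
    where
    open ≡-Reasoning
    copies : ∑ (λ y → ι (cnt y) * δ y x) ≡ ι (cnt x)
    copies = trans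
      (∑-single x _ λ y x≢y → trans (cong (ι (cnt y) *_) (δ-≢ (x≢y ∘ sym))) (*-zeroʳ (ι (cnt y))))
      (trans (cong (ι (cnt x) *_) (δ-refl x)) (*-identityʳ (ι (cnt x))))

  expectVR≤iid : ∀ {f} → Dispersive k f → indep draws f ≤ indep (replicate k P) f
  expectVR≤iid {f} D = subst (λ l → indep draws f ≤ indep (replicate l P) f) draws-length
    (indep≤iid draws P (subst (λ l → Dispersive l f) (sym draws-length) D) draws-prob pr
      (subst (λ l → ∀ x → ι l * P x ≡ total draws x) (sym draws-length) draws-average))


-- The comparison with `O`.

matchCost-dispersive : ∀ {n} (d : Fin n → Fin n → ℚ) T {k} → length T ≡ k →
  Dispersive k (λ S → matchCost d S T)
matchCost-dispersive d T refl = record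
  { symmetric = matchCost-↭ d
  ; psd       = λ Z eq E → fourPoint-psd (λ x y → matchCost d (x ∷ y ∷ Z) T)
      (λ x y → matchCost-↭ d {x ∷ y ∷ Z} {y ∷ x ∷ Z} {T} eq (↭-swap₂ x y ↭-refl)) (matchCost-fourPoint d Z T eq) E }

theorem4 : ∀ {n : ℕ} (d : Fin n → Fin n → ℚ) → IsMetric d →
    (P : Fin n → ℚ) → IsProb P →
    (k : ℕ) → .{{_ : NonZero k}} →
    (O : Vec (Fin n) k) →
    (∀ (U : Vec (Fin n) k) → expCost d P k (toList O) ≤ expCost d P k (toList U)) →
    expectVR P k (λ S → expCost d P k S) ≤ (+ 4 / 1) * expCost d P k (toList O)
theorem4 d metric P pr k O _ = begin
  expectVR P k (expCost d P k)
    ≡⟨ expectVR≡indep P pr k _ ⟩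
  indep ps (expCost d P k)
    ≡⟨ indep-cong ps (λ S _ → sym (indep-replicate k P (cost S))) ⟩
  indep ps (λ S → indep Pᵏ (cost S))
    -- `X` goes outside, so that the comparison of laws applies to each fixed `X`.
    ≡⟨ indep-swap ps Pᵏ cost ⟩
  indep Pᵏ (λ X → indep ps (λ S → cost S X))
    ≤⟨ indep-mono prᵏ (λ X eq → expectVR≤iid P pr k (matchCost-dispersive d X (trans eq |Pᵏ|))) ⟩
  indep Pᵏ (λ X → indep Pᵏ (λ Y → cost Y X))
    ≤⟨ indep-mono prᵏ (λ X eqX → indep-mono prᵏ (λ Y eqY → through X Y (trans eqX |Pᵏ|) (trans eqY |Pᵏ|))) ⟩
  indep Pᵏ (λ X → indep Pᵏ (λ Y → cost o Y + cost o X))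
    -- `X` and `Y` have the same law, so each of the two terms averages to `C`.
    ≡⟨ indep-cong Pᵏ (λ X _ → trans (indep-+ Pᵏ (cost o) (λ _ → cost o X))
         (cong (_+_ (indep Pᵏ (cost o))) (indep-const prᵏ (cost o X)))) ⟩
  indep Pᵏ (λ X → C + cost o X)
    ≡⟨ trans (indep-+ Pᵏ (λ _ → C) (cost o)) (cong (_+ C) (indep-const prᵏ C)) ⟩
  C + C
    -- The factor is 2 at this point; `0≤C` allows it to be raised to 4.
    ≤⟨ subst₂ _≤_ (+-identityʳ (C + C)) (solve 1 (λ c → (c :+ c) :+ (c :+ c) := con (+ 4 / 1) :* c) refl C)
         (+-monoʳ-≤ (C + C) (0≤+ 0≤C 0≤C)) ⟩
  (+ 4 / 1) * C
    ≡⟨ cong ((+ 4 / 1) *_) (indep-replicate k P (cost o)) ⟩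
  (+ 4 / 1) * expCost d P k o ∎
  where
  open ≤-Reasoning
  open IsMetric metric
  o = toList O
  cost = matchCost d
  ps = draws P pr k
  Pᵏ = replicate k P
  C = indep Pᵏ (cost o)
  prᵏ : All IsProb Pᵏ
  prᵏ = All.replicate⁺ k pr
  |Pᵏ| : length Pᵏ ≡ k
  |Pᵏ| = length-replicate k
  |o| : length o ≡ k
  |o| = length-toList O
  through : ∀ X Y → length X ≡ k → length Y ≡ k → cost Y X ≤ cost o Y + cost o X
  through X Y |X| |Y| = ≤-trans
    (matchCost-triangle d triangle Y o X (trans |Y| (sym |o|)) (trans |o| (sym |X|)))
    (+-monoˡ-≤ (cost o X) (matchCost-sym d symm Y o (trans |Y| (sym |o|))))
  0≤C : 0ℚ ≤ C
  0≤C = subst (_≤ C) (indep-const prᵏ 0ℚ)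
    (indep-mono prᵏ λ X eq → matchCost-nonneg d nonneg o X (trans |o| (sym (trans eq |Pᵏ|))))
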